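{- The map $\mathrm{Pr} : \mathcal{D} \to \mathcal{P}(\Sigma^\omega)$ is monotone and preserves least upper bounds and greatest lower bounds; that is, for definitive sets $X, Y$ and any family $(X_i)_{i\in I}$ of definitive sets: (1) if $X \subseteq Y$ then $\mathrm{Pr}(X) \subseteq \mathrm{Pr}(Y)$; (2) $\mathrm{Pr}(\bigcap_{i\in I} X_i) = \bigcap_{i \in I} \mathrm{Pr}(X_i)$; (3) $\mathrm{Pr}(\bigsqcup_{i\in I} X_i) = \bigcup_{i\in I} \mathrm{Pr}(X_i)$. Likewise, the map $\mathrm{Df} : \mathcal{P}(\Sigma^\omega) \to \mathcal{D}$ is monotone and preserves least upper bounds and greatest lower bounds; that is, for $P, Q \subseteq \Sigma^\omega$ and any family $(P_i)_{i \in I}$ of subsets of $\Sigma^\omega$: if $P \subseteq Q$ then $\mathrm{Df}(P) \subseteq \mathrm{Df}(Q)$; $\mathrm{Df}(\bigcap_{i\in I} P_i) = \bigcap_{i\in I}\mathrm{Df}(P_i)$; and $\mathrm{Df}(\bigcup_{i\in I} P_i) = \bigsqcup_{i\in I}\mathrm{Df}(P_i)$.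
   Context: Fix a set $A$ of atomic propositions and let $\Sigma = \mathcal{P}(A)$ be the set of states. $\Sigma^*$ is the set of finite traces (finite sequences of states, including the empty trace $\varepsilon$), $\Sigma^\omega$ the set of infinite traces, and $\Sigma^\infty = \Sigma^* \cup \Sigma^\omega$. Traces $t,u$ are concatenated as $tu$, with $tu = t$ if $t$ is infinite. For $X \subseteq \Sigma^\infty$, $\downarrow X = \{u \mid \exists t \in X.\ \exists v \in \Sigma^\infty.\ t = uv\}$ is the set of prefixes of traces in $X$; for a trace $t$, $\uparrow t = \{tu \mid u \in \Sigma^\infty\}$ is its set of extensions. The set of definitive prefixes of $X\subseteq\Sigma^\infty$ is $\mathrm{dp}(X) = \{t \in \Sigma^\infty \mid \uparrow t \subseteq \downarrow X\}$. A set $X \subseteq \Sigma^\infty$ is definitive iff $X = \mathrm{dp}(X)$; $\mathcal{D}$ denotes the set of all definitive sets, ordered by inclusion; it is a complete lattice with infimum given by intersection and supremum given by the definitive union $\bigsqcup_{i\in I} X_i = \mathrm{dp}(\bigcup_{i\in I} X_i)$. $\mathcal{P}(\Sigma^\omega)$ is ordered by inclusion. The maps are $\mathrm{Pr}(X) = X \cap \Sigma^\omega$ and $\mathrm{Df}(P) = \mathrm{dp}(P)$ (which is always definitive). An intersection over the empty family is the greatest element of the lattice in question: $\Sigma^\infty$ in $\mathcal{D}$ and $\Sigma^\omega$ in $\mathcal{P}(\Sigma^\omega)$. -}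

module Defs where

open import Data.Empty.Polymorphic using (⊥)
open import Data.List.Base using (List; []; _∷_; _++_)
import Data.List.Relation.Binary.Equality.Setoid as ListEquality
open import Data.Nat.Base using (ℕ; zero; suc)
open import Data.Product.Base using (_×_; _,_; ∃-syntax; proj₂)
open import Data.Sum.Base using (_⊎_; inj₁; inj₂)
open import Data.Sum.Relation.Binary.Pointwise using (inj₁; inj₂; ⊎-setoid)
import Function.Indexed.Relation.Binary.Equality as IndexedEquality
open import Level using (Level; _⊔_) renaming (suc to lsuc)
open import Relation.Binary.Bundles using (Setoid)
open import Relation.Binary.Definitions using (_Respects_)
import Relation.Binary.Indexed.Heterogeneous.Construct.Trivial as Trivial
open import Relation.Unary as U using (Pred)
open import Relation.Unary.Relation.Binary.Equality using (≐-setoid)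

-- Equality of traces is not propositional, so a set of traces is a
-- predicate that is invariant under trace equality.

record Subset {c e} (S : Setoid c e) (ℓ : Level) : Set (c ⊔ e ⊔ lsuc ℓ) where
  field
    pred : Pred (Setoid.Carrier S) ℓ
    resp : pred Respects Setoid._≈_ S

open Subset public

module _ {c e} {S : Setoid c e} where

  infix 4 _∈_ _⊆_ _≐_

  _∈_ : ∀ {ℓ} → Setoid.Carrier S → Subset S ℓ → Set ℓ
  x ∈ X = pred X x

  _⊆_ : ∀ {ℓ} → Subset S ℓ → Subset S ℓ → Set (c ⊔ ℓ)
  X ⊆ Y = pred X U.⊆ pred Y

  _≐_ : ∀ {ℓ} → Subset S ℓ → Subset S ℓ → Set (c ⊔ ℓ)
  X ≐ Y = pred X U.≐ pred Y

  ⋂ : ∀ {i ℓ} {I : Set i} → (I → Subset S ℓ) → Subset S (i ⊔ ℓ)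
  ⋂ {I = I} X .pred = U.⋂ I (λ i → pred (X i))
  ⋂ X .resp x≈y x∈ i = resp (X i) x≈y (x∈ i)

  ⋃ : ∀ {i ℓ} {I : Set i} → (I → Subset S ℓ) → Subset S (i ⊔ ℓ)
  ⋃ {I = I} X .pred = U.⋃ I (λ i → pred (X i))
  ⋃ X .resp x≈y (i , x∈) = i , resp (X i) x≈y x∈

-- A is the set of atomic propositions and s the level of the predicates
-- representing its subsets. Sets of traces live at level L, which bounds
-- the level of the type of traces so that dp does not raise the level.

module Traces {a : Level} (A : Set a) (s ℓ : Level) where

  L : Level
  L = a ⊔ lsuc s ⊔ ℓ

  State : Set (a ⊔ lsuc s)
  State = Pred A s

  State-setoid : Setoid (a ⊔ lsuc s) (a ⊔ s)
  State-setoid = ≐-setoid A s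

  FinTrace : Set (a ⊔ lsuc s)
  FinTrace = List State

  FinTrace-setoid : Setoid (a ⊔ lsuc s) (a ⊔ lsuc s)
  FinTrace-setoid = ListEquality.≋-setoid State-setoid

  InfTrace : Set (a ⊔ lsuc s)
  InfTrace = ℕ → State

  InfTrace-setoid : Setoid (a ⊔ lsuc s) (a ⊔ s)
  InfTrace-setoid =
    IndexedEquality.≡-setoid ℕ (Trivial.indexedSetoid State-setoid)

  Trace : Set (a ⊔ lsuc s)
  Trace = FinTrace ⊎ InfTrace

  Trace-setoid : Setoid (a ⊔ lsuc s) (a ⊔ lsuc s)
  Trace-setoid = ⊎-setoid FinTrace-setoid InfTrace-setoid

  open Setoid Trace-setoid public
    using (_≈_) renaming (refl to ≈-refl; sym to ≈-sym; trans to ≈-trans)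

  𝒫∞ : Set (lsuc L)
  𝒫∞ = Subset Trace-setoid L

  𝒫ω : Set (lsuc L)
  𝒫ω = Subset InfTrace-setoid L

  infixr 5 _++ω_
  infixr 6 _·_

  _++ω_ : FinTrace → InfTrace → InfTrace
  ([]       ++ω w) n       = w n
  ((x ∷ xs) ++ω w) zero    = x
  ((x ∷ xs) ++ω w) (suc n) = (xs ++ω w) n

  _·_ : Trace → Trace → Trace
  inj₁ xs · inj₁ ys = inj₁ (xs ++ ys)
  inj₁ xs · inj₂ w  = inj₂ (xs ++ω w)
  inj₂ w  · _       = inj₂ w

  ↓ : 𝒫∞ → Pred Trace L
  ↓ X u = ∃[ t ] t ∈ X × ∃[ v ] t ≈ u · v

  ↑ : Trace → Pred Trace (a ⊔ lsuc s)
  ↑ t u = ∃[ v ] u ≈ t · v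

  private
    module ≋ = ListEquality State-setoid
    module ω = Setoid InfTrace-setoid
    module St = Setoid State-setoid

    ++ω-cong : ∀ {xs ys v w} → xs ≋.≋ ys → v ω.≈ w → (xs ++ω v) ω.≈ (ys ++ω w)
    ++ω-cong ≋.[]        q n       = q n
    ++ω-cong (p ≋.∷ ps)  q zero    = p
    ++ω-cong (p ≋.∷ ps)  q (suc n) = ++ω-cong ps q n

    ++ω-assoc : ∀ xs ys w → ((xs ++ ys) ++ω w) ω.≈ (xs ++ω (ys ++ω w))
    ++ω-assoc []       ys w n       = St.refl
    ++ω-assoc (x ∷ xs) ys w zero    = St.refl
    ++ω-assoc (x ∷ xs) ys w (suc n) = ++ω-assoc xs ys w n

    ++-assoc : ∀ xs ys zs → ((xs ++ ys) ++ zs) ≋.≋ (xs ++ (ys ++ zs))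
    ++-assoc []       ys zs = ≋.≋-refl
    ++-assoc (x ∷ xs) ys zs = St.refl ≋.∷ ++-assoc xs ys zs

    ++-identityʳ : ∀ xs → (xs ++ []) ≋.≋ xs
    ++-identityʳ []       = ≋.[]
    ++-identityʳ (x ∷ xs) = St.refl ≋.∷ ++-identityʳ xs

  ·-congʳ : ∀ {t u} v → t ≈ u → t · v ≈ u · v
  ·-congʳ (inj₁ ys) (inj₁ p) = inj₁ (≋.++⁺ p ≋.≋-refl)
  ·-congʳ (inj₂ w)  (inj₁ p) = inj₂ (++ω-cong p ω.refl)
  ·-congʳ v         (inj₂ p) = inj₂ p

  ·-assoc : ∀ t u v → (t · u) · v ≈ t · (u · v)
  ·-assoc (inj₁ xs) (inj₁ ys) (inj₁ zs) = inj₁ (++-assoc xs ys zs)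
  ·-assoc (inj₁ xs) (inj₁ ys) (inj₂ w)  = inj₂ (++ω-assoc xs ys w)
  ·-assoc (inj₁ xs) (inj₂ w)  v         = ≈-refl
  ·-assoc (inj₂ w)  u         v         = ≈-refl

  ·-identityʳ : ∀ t → t · inj₁ [] ≈ t
  ·-identityʳ (inj₁ xs) = inj₁ (++-identityʳ xs)
  ·-identityʳ (inj₂ w)  = ≈-refl

  ↑-refl : ∀ t → ↑ t t
  ↑-refl t = inj₁ [] , ≈-sym (·-identityʳ t)

  ↑-trans : ∀ {t u v} → ↑ t u → ↑ u v → ↑ t v
  ↑-trans {t} (x , u≈tx) (y , v≈uy) =
    x · y , ≈-trans v≈uy (≈-trans (·-congʳ y u≈tx) (·-assoc t x y))

  dp : 𝒫∞ → 𝒫∞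
  dp X .pred t = ↑ t U.⊆′ ↓ X
  dp X .resp t≈t′ h u (v , u≈t′v) =
    h u (v , ≈-trans u≈t′v (·-congʳ v (≈-sym t≈t′)))

  Definitive : 𝒫∞ → Set L
  Definitive X = X ≐ dp X

  record 𝒟 : Set (lsuc L) where
    field
      set        : 𝒫∞
      definitive : Definitive set

  open 𝒟 public

  dp-extend : ∀ X {t u} → t ∈ dp X → ↑ t u → u ∈ dp X
  dp-extend X t∈ t≤u v u≤v = t∈ v (↑-trans t≤u u≤v)

  ⊆-↓ : ∀ X {t} → t ∈ X → ↓ X t
  ⊆-↓ X {t} t∈ = t , t∈ , ↑-refl t

  ↓-dp : ∀ X {u} → ↓ (dp X) u → ↓ X u
  ↓-dp X (t , t∈ , u≤t) with t∈ t (↑-refl t)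
  ... | t′ , t′∈ , t≤t′ = t′ , t′∈ , ↑-trans u≤t t≤t′

  dp-definitive : ∀ X → Definitive (dp X)
  dp-definitive X =
      (λ t∈ u t≤u → ⊆-↓ (dp X) (dp-extend X t∈ t≤u))
    , (λ t∈ u t≤u → ↓-dp X (t∈ u t≤u))

  ⋂-definitive : {I : Set L} (X : I → 𝒟) → Definitive (⋂ (λ i → set (X i)))
  ⋂-definitive X =
      (λ t∈ u t≤u → ⊆-↓ (⋂ (λ i → set (X i))) λ i →
        let (⊆dp , dp⊆) = definitive (X i)
        in dp⊆ (dp-extend (set (X i)) (⊆dp (t∈ i)) t≤u))
    , (λ t∈ i → proj₂ (definitive (X i)) λ u t≤u →
        let (t′ , t′∈ , u≤t′) = t∈ u t≤u
        in t′ , t′∈ i , u≤t′)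

  infix 4 _⊑_ _≐ᴰ_

  _⊑_ : 𝒟 → 𝒟 → Set L
  X ⊑ Y = set X ⊆ set Y

  _≐ᴰ_ : 𝒟 → 𝒟 → Set L
  X ≐ᴰ Y = set X ≐ set Y

  ⨅ : {I : Set L} → (I → 𝒟) → 𝒟
  ⨅ X .set        = ⋂ (λ i → set (X i))
  ⨅ X .definitive = ⋂-definitive X

  ⨆ : {I : Set L} → (I → 𝒟) → 𝒟
  ⨆ X .set        = dp (⋃ (λ i → set (X i)))
  ⨆ X .definitive = dp-definitive (⋃ (λ i → set (X i)))

  Pr : 𝒟 → 𝒫ω
  Pr X .pred w     = inj₂ w ∈ set X
  Pr X .resp v≈w v∈ = resp (set X) (inj₂ v≈w) v∈

  ι : 𝒫ω → 𝒫∞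
  ι P .pred (inj₁ _) = ⊥
  ι P .pred (inj₂ w) = w ∈ P
  ι P .resp (inj₂ v≈w) v∈ = resp P v≈w v∈

  Df : 𝒫ω → 𝒟
  Df P .set        = dp (ι P)
  Df P .definitive = dp-definitive (ι P)

{-# OPTIONS --safe #-}

-- An infinite trace extends only to itself, so it lies in ↓ X, or in dp X,
-- exactly when it lies in X; this gives the claims about Pr. As every trace
-- has an infinite extension, t ∈ dp (ι P) can be tested on the infinite
-- extensions of t, a condition that commutes with intersections. For unions,
-- dp X depends only on ↓ X, and ↓ (dp X) = ↓ X.

module Submission where

open import Defs
open import Data.Empty.Polymorphic using (⊥)
open import Data.Product.Base using (_×_; _,_; ∃-syntax)
open import Data.Sum.Base using (inj₁; inj₂)
open import Function.Base using (id)
open import Level using (Level)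
import Relation.Unary as U

module _ {a : Level} (A : Set a) (s ℓ : Level) where
  open Traces A s ℓ

  ↓-mono : ∀ (X Y : 𝒫∞) → X ⊆ Y → ↓ X U.⊆ ↓ Y
  ↓-mono X Y X⊆Y (t , t∈X , u≤t) = t , X⊆Y t∈X , u≤t

  -- Comparing prefixes rather than members is what `Df-⋃` needs.
  dp-mono-↓ : ∀ (X Y : 𝒫∞) → ↓ X U.⊆ ↓ Y → dp X ⊆ dp Y
  dp-mono-↓ X Y ↓X⊆↓Y t∈ u t≤u = ↓X⊆↓Y (t∈ u t≤u)

  ↓-infinite : ∀ (X : 𝒫∞) {w} → ↓ X (inj₂ w) → inj₂ w ∈ X
  -- `inj₂ w · v` reduces to `inj₂ w`, so `t≈w` is already `t ≈ inj₂ w`.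
  ↓-infinite X (t , t∈X , v , t≈w) = resp X t≈w t∈X

  dp-infinite : ∀ (X : 𝒫∞) {w} → inj₂ w ∈ dp X → inj₂ w ∈ X
  dp-infinite X {w} w∈ = ↓-infinite X (w∈ (inj₂ w) (↑-refl (inj₂ w)))

  infinite-dp : ∀ (X : 𝒫∞) {w} → inj₂ w ∈ X → inj₂ w ∈ dp X
  infinite-dp X w∈X u (v , u≈w) = ⊆-↓ X (resp X (≈-sym u≈w) w∈X)

  infinite-extension : ∀ t → ∃[ w ] ↑ t (inj₂ w)
  -- The empty state, available for every `A`, fills the tail.
  infinite-extension (inj₁ xs) = xs ++ω (λ _ _ → ⊥) , inj₂ (λ _ _ → ⊥) , ≈-refl
  infinite-extension (inj₂ w)  = w , ↑-refl (inj₂ w)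

  ι-mono : ∀ (P Q : 𝒫ω) → P ⊆ Q → ι P ⊆ ι Q
  ι-mono P Q P⊆Q {inj₂ w} w∈P = P⊆Q w∈P

  dp-ι-intro : ∀ (P : 𝒫ω) {t} → (∀ w → ↑ t (inj₂ w) → w ∈ P) → t ∈ dp (ι P)
  dp-ι-intro P h u t≤u =
    let (w , u≤w) = infinite-extension u
    in inj₂ w , h w (↑-trans t≤u u≤w) , u≤w

  dp-ι-elim : ∀ (P : 𝒫ω) {t} → t ∈ dp (ι P) → ∀ w → ↑ t (inj₂ w) → w ∈ P
  dp-ι-elim P t∈ w t≤w = ↓-infinite (ι P) (t∈ (inj₂ w) t≤w)

  Pr-⨆ : {I : Set L} (X : I → 𝒟) → Pr (⨆ X) ≐ ⋃ (λ i → Pr (X i))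
  Pr-⨆ X = dp-infinite ⋃X , infinite-dp ⋃X
    where ⋃X = ⋃ (λ i → set (X i))

  Df-mono : ∀ (P Q : 𝒫ω) → P ⊆ Q → Df P ⊑ Df Q
  Df-mono P Q P⊆Q =
    dp-mono-↓ (ι P) (ι Q) (↓-mono (ι P) (ι Q) λ {t} → ι-mono P Q P⊆Q {t})

  Df-⋂ : {I : Set L} (P : I → 𝒫ω) → Df (⋂ P) ≐ᴰ ⨅ (λ i → Df (P i))
  Df-⋂ P =
      (λ t∈ i → Df-mono (⋂ P) (P i) (λ w∈ → w∈ i) t∈)
    -- The prefix witnesses in `t∈ i` may vary with `i`; fixing the infinite `w` first removes this
    -- dependence.
    , (λ t∈ → dp-ι-intro (⋂ P) λ w t≤w i → dp-ι-elim (P i) (t∈ i) w t≤w)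

  Df-⋃ : {I : Set L} (P : I → 𝒫ω) → Df (⋃ P) ≐ᴰ ⨆ (λ i → Df (P i))
  Df-⋃ P =
      dp-mono-↓ (ι (⋃ P)) ⋃Df (↓-mono (ι (⋃ P)) ⋃Df λ {t} → ι⋃⊆⋃Df {t})
    -- `⋃Df` may contain finite traces, so it need not lie in `ι (⋃ P)`; it lies in `dp (ι (⋃ P))`,
    -- whose prefixes are prefixes of `ι (⋃ P)`.
    , dp-mono-↓ ⋃Df (ι (⋃ P)) λ u∈ →
        ↓-dp (ι (⋃ P)) (↓-mono ⋃Df (dp (ι (⋃ P))) ⋃Df⊆Df⋃ u∈)
    where
    ⋃Df : 𝒫∞
    ⋃Df = ⋃ (λ i → set (Df (P i)))

    ι⋃⊆⋃Df : ι (⋃ P) ⊆ ⋃Df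
    ι⋃⊆⋃Df {inj₂ w} (i , w∈) = i , infinite-dp (ι (P i)) w∈

    ⋃Df⊆Df⋃ : ⋃Df ⊆ set (Df (⋃ P))
    ⋃Df⊆Df⋃ (i , t∈) = Df-mono (P i) (⋃ P) (i ,_) t∈

theorem3 : ∀ {a : Level} (A : Set a) (s ℓ : Level) → let open Traces A s ℓ in
    ( (∀ (X Y : 𝒟) → X ⊑ Y → Pr X ⊆ Pr Y)
    × (∀ (I : Set L) (X : I → 𝒟) → Pr (⨅ X) ≐ ⋂ (λ i → Pr (X i)))
    × (∀ (I : Set L) (X : I → 𝒟) → Pr (⨆ X) ≐ ⋃ (λ i → Pr (X i))) )
    × ( (∀ (P Q : 𝒫ω) → P ⊆ Q → Df P ⊑ Df Q)
    × (∀ (I : Set L) (P : I → 𝒫ω) → Df (⋂ P) ≐ᴰ ⨅ (λ i → Df (P i)))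
    × (∀ (I : Set L) (P : I → 𝒫ω) → Df (⋃ P) ≐ᴰ ⨆ (λ i → Df (P i))) )
theorem3 A s ℓ =
    ( (λ X Y X⊑Y → X⊑Y)
    -- Intersections are pointwise, so both sides unfold to the same predicate.
    , (λ I X → id , id)
    , (λ I → Pr-⨆ A s ℓ) )
  , ( Df-mono A s ℓ
    , (λ I → Df-⋂ A s ℓ)
    , (λ I → Df-⋃ A s ℓ) )
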